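{- Let $N\ge 5$ be an integer. The supremum $\sup_{E\in\mathcal{T}^N_3}P^N_s(E)$ is realised by the trunk graph whose associated sequence is $$\left(1,1,\left\lfloor \tfrac N3\right\rfloor-1\right)\ \text{ if } N\equiv 0 \pmod 3,\qquad \left(1,3,\left\lfloor \tfrac N3\right\rfloor-2\right)\ \text{ if } N\equiv 1\pmod 3,\qquad \left(1,2,\left\lfloor \tfrac N3\right\rfloor-1\right)\ \text{ if } N\equiv 2\pmod 3.$$
   Context: A trunk graph with $N$ edges is a directed graph with vertices $v_1,\dots,v_n$ ($n\ge2$) such that every edge goes from some $v_i$ to $v_{i+1}$, there are $m_i\ge1$ edges from $v_i$ to $v_{i+1}$ for each $1\le i\le n-1$, and $m_1+\dots+m_{n-1}=N$. It is written $(m_1,\dots,m_{n-1})$. $\mathcal{T}^N_3$ is the set of trunk graphs with $N$ edges and all $m_i\le 3$. A trunk graph has associated sequence $(n_1,n_2,n_3)$ (with $n_1,n_2,n_3\ge0$) if $(m_1,\dots,m_{n-1})$ consists of $n_1$ ones, followed by $n_2$ twos, followed by $n_3$ threes. $P^N_s(E)$ is the number of finite directed paths in $E$ (including the path of length $0$) ending at the unique sink $v_n$. -}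

module Defs where

open import Data.Nat using (ℕ; zero; suc; _+_; _*_; _≤_)
open import Data.Empty using (⊥; ⊥-elim)
open import Data.Fin using (Fin; zero; suc; inject₁; fromℕ)
open import Data.Fin.Properties using (1↔⊤; +↔⊎; *↔×)
open import Data.List using (List; []; _∷_; _++_; length; lookup; replicate)
open import Data.Nat.ListAction using (sum)
open import Data.List.Relation.Unary.All using (All)
open import Data.Product using (Σ-syntax; ∃; _×_; _,_; proj₁)
open import Data.Product.Function.NonDependent.Propositional using (_×-↔_)
open import Data.Sum using (_⊎_; inj₁; inj₂)
open import Data.Sum.Function.Propositional using (_⊎-↔_)
open import Data.Unit using (tt)
open import Function.Base using (_∘_)
open import Function.Bundles using (_↔_; mk↔ₛ′)
open import Function.Construct.Composition using (_↔-∘_)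
open import Function.Construct.Symmetry using (↔-sym)
open import Function.Construct.Identity using (↔-id)
open import Relation.Binary.Construct.Closure.ReflexiveTransitive using (Star; ε; _◅_; gmap)
open import Relation.Binary.PropositionalEquality using (_≡_; refl; cong)

-- A multiplicity list (m₁, …, mₙ₋₁) has n = 1 + length vertices; the vertex vᵢ
-- is the element i - 1 of Fin n.
Vertex : List ℕ → Set
Vertex ms = Fin (suc (length ms))

data Edge (ms : List ℕ) : Vertex ms → Vertex ms → Set where
  edge : (i : Fin (length ms)) → Fin (lookup ms i) → Edge ms (inject₁ i) (suc i)

-- Edge is proof-relevant, so Star keeps parallel edges apart and its elements
-- are exactly the finite directed paths, ε being a path of length 0.
Path : (ms : List ℕ) → Vertex ms → Vertex ms → Set
Path ms = Star (Edge ms)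

sink : (ms : List ℕ) → Vertex ms
sink ms = fromℕ (length ms)

PathToSink : List ℕ → Set
PathToSink ms = ∃ λ v → Path ms v (sink ms)

record TrunkGraph (N : ℕ) : Set where
  field
    mult        : List ℕ
    twoVertices : 2 ≤ suc (length mult)
    positive    : All (1 ≤_) mult
    edgeCount   : sum mult ≡ N

open TrunkGraph public

𝒯₃ : ℕ → Set
𝒯₃ N = Σ[ E ∈ TrunkGraph N ] All (_≤ 3) (mult E)

HasAssociatedSequence : ∀ {N} → TrunkGraph N → ℕ → ℕ → ℕ → Set
HasAssociatedSequence E n₁ n₂ n₃ =
  mult E ≡ replicate n₁ 1 ++ replicate n₂ 2 ++ replicate n₃ 3

-- Paths in m ∷ ms ending at a vertex suc w, sorted by their start: from the
-- first vertex, one of m edges followed by a path in ms; from any other vertex,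
-- a path in ms.
module _ {m : ℕ} {ms : List ℕ} {w : Vertex ms} where

  Split : Vertex (m ∷ ms) → Set
  Split zero    = Fin m × Path ms zero w
  Split (suc v) = Path ms v w

  split : ∀ {a} → Path (m ∷ ms) a (suc w) → Split a
  split ε                    = ε
  split (edge zero j ◅ p)    = j , split p
  split (edge (suc i) j ◅ p) = edge i j ◅ split p

  shift : ∀ {v} → Path ms v w → Path (m ∷ ms) (suc v) (suc w)
  shift = gmap suc λ { (edge i j) → edge (suc i) j }

  unsplit : ∀ a → Split a → Path (m ∷ ms) a (suc w)
  unsplit zero    (j , p) = edge zero j ◅ shift p
  unsplit (suc v) p       = shift p

  split-shift : ∀ {v} (p : Path ms v w) → split (shift p) ≡ p
  split-shift ε              = refl
  split-shift (edge i j ◅ p) = cong (edge i j ◅_) (split-shift p)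

  split-unsplit : ∀ a (s : Split a) → split (unsplit a s) ≡ s
  split-unsplit zero    (j , p) = cong (j ,_) (split-shift p)
  split-unsplit (suc v) p       = split-shift p

  unsplit-split : ∀ {a} (p : Path (m ∷ ms) a (suc w)) → unsplit a (split p) ≡ p
  unsplit-split ε                    = refl
  unsplit-split (edge zero j ◅ p)    = cong (edge zero j ◅_) (unsplit-split p)
  unsplit-split (edge (suc i) j ◅ p) = cong (edge (suc i) j ◅_) (unsplit-split p)

  split↔ : ∀ a → Path (m ∷ ms) a (suc w) ↔ Split a
  split↔ a = mk↔ₛ′ split (unsplit a) (split-unsplit a) unsplit-split

  splitStart↔ : (∃ λ a → Path (m ∷ ms) a (suc w)) ↔
                ((Fin m × Path ms zero w) ⊎ (∃ λ v → Path ms v w))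
  splitStart↔ = mk↔ₛ′ to from to∘from from∘to
    where
    to : (∃ λ a → Path (m ∷ ms) a (suc w)) →
         (Fin m × Path ms zero w) ⊎ (∃ λ v → Path ms v w)
    to (zero  , p) = inj₁ (split p)
    to (suc v , p) = inj₂ (v , split p)

    from : (Fin m × Path ms zero w) ⊎ (∃ λ v → Path ms v w) →
           ∃ λ a → Path (m ∷ ms) a (suc w)
    from (inj₁ s)       = zero , unsplit zero s
    from (inj₂ (v , p)) = suc v , shift p

    to∘from : ∀ s → to (from s) ≡ s
    to∘from (inj₁ s)       = cong inj₁ (split-unsplit zero s)
    to∘from (inj₂ (v , p)) = cong (inj₂ ∘ (v ,_)) (split-shift p)

    from∘to : ∀ p → from (to p) ≡ p
    from∘to (zero  , p) = cong (zero ,_) (unsplit-split p)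
    from∘to (suc v , p) = cong (suc v ,_) (unsplit-split p)

noEdge : ∀ {v w} → Edge [] v w → ⊥
noEdge (edge () _)

onlyε : (p : Path [] zero zero) → ε ≡ p
onlyε ε       = refl
onlyε (e ◅ _) = ⊥-elim (noEdge e)

sourceToSinkFinite : ∀ ms → Σ[ k ∈ ℕ ] (Path ms zero (sink ms) ↔ Fin k)
sourceToSinkFinite []       = 1 , ↔-sym 1↔⊤ ↔-∘ mk↔ₛ′ (λ _ → tt) (λ _ → ε) (λ _ → refl) onlyε
sourceToSinkFinite (m ∷ ms) with sourceToSinkFinite ms
... | k , e = m * k , ↔-sym *↔× ↔-∘ ((↔-id (Fin m) ×-↔ e) ↔-∘ split↔ zero)

pathsToSinkFinite : ∀ ms → Σ[ k ∈ ℕ ] (PathToSink ms ↔ Fin k)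
pathsToSinkFinite [] = 1 , ↔-sym 1↔⊤ ↔-∘ mk↔ₛ′ (λ _ → tt) (λ _ → zero , ε) (λ _ → refl)
                                            λ { (zero , p) → cong (zero ,_) (onlyε p) }
pathsToSinkFinite (m ∷ ms) with sourceToSinkFinite ms | pathsToSinkFinite ms
... | k , e | l , f =
  m * k + l , ↔-sym +↔⊎ ↔-∘ (((↔-sym *↔× ↔-∘ (↔-id (Fin m) ×-↔ e)) ⊎-↔ f) ↔-∘ splitStart↔)

-- The cardinality of PathToSink (mult E), counted by the bijection with Fin.
Pₛ : ∀ {N} → TrunkGraph N → ℕ
Pₛ E = proj₁ (pathsToSinkFinite (mult E))

IsSupremum : {A : Set} → (A → ℕ) → ℕ → Set
IsSupremum f s = (∀ a → f a ≤ s) × (∀ u → (∀ a → f a ≤ u) → s ≤ u)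

SupremumRealisedBy : (N n₁ n₂ n₃ : ℕ) → Set
SupremumRealisedBy N n₁ n₂ n₃ =
  Σ[ (E , _) ∈ 𝒯₃ N ] HasAssociatedSequence E n₁ n₂ n₃
                    × IsSupremum {𝒯₃ N} (λ (F , _) → Pₛ F) (Pₛ E)

module Submission where

-- Counting paths to the sink according to their last edge: adding a final
-- bundle of m edges to a trunk graph turns a count of P into 1 + m * P, since a
-- path to the new sink is either the path of length 0 or a path to the old sink
-- followed by one of the m new edges (pathCount-∷ʳ). This is increasing in P, so
-- the last bundle of an optimal graph is preceded by an optimal graph, and the
-- maximum over graphs with n edges and multiplicities at most 3 satisfies
--
--   best n = max over 1 ≤ m ≤ 3, m ≤ n, of 1 + m * best (n ∸ m),   best 0 = 1.
--
-- The solution starts 1, 2, 3, 5, 7, 11, 16, 23, and from n = 8 on the maximum is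
-- attained at m = 3. The reason is that one more edge increases the optimum by
-- a factor of at most 3/2 once there are at least 5 edges (best-growth), so
-- ending in 3 is no worse than ending in 2 or, applying the factor twice
-- (9/4 < 3), in 1. Induction along the list from its last entry gives the upper
-- bound pathCount≤best.
--
-- The bound is attained by (1,2), (1,2,2) and (1,2,2,2), which have 3, 5 and 7
-- edges, one number for each residue class mod 3, and it stays attained when 3s
-- are appended to these, because best (3 + n) = 1 + 3 * best n for n = 3 and for
-- all n ≥ 5.

open import Defs
open import Data.List using (List; []; _∷_; _++_; _∷ʳ_; replicate)
open import Data.List.Properties using (++-assoc; ++-identityʳ)
open import Data.List.Relation.Unary.All using (All; []; _∷_)
open import Data.List.Relation.Unary.All.Properties using (++⁺; ∷ʳ⁻; replicate⁺)
open import Data.List.Reverse using (Reverse; []; _∶_∶ʳ_; reverseView)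
open import Data.Nat using (ℕ; zero; suc; _+_; _*_; _≤_; _∸_; _/_; _%_; z≤n; s≤s)
open import Data.Nat.DivMod using (m≡m%n+[m/n]*n)
open import Data.Nat.ListAction using (sum)
open import Data.Nat.ListAction.Properties using (sum-++)
open import Data.Nat.Properties
open import Data.Nat.Tactic.RingSolver using (solve-∀)
open import Data.Product using (_×_; _,_; proj₁)
open import Relation.Binary.PropositionalEquality
  using (_≡_; refl; trans; cong; cong₂; subst; module ≡-Reasoning)

-- The number of paths to the sink

sourceToSinkCount : List ℕ → ℕ
sourceToSinkCount ms = proj₁ (sourceToSinkFinite ms)

pathCount : List ℕ → ℕ
pathCount ms = proj₁ (pathsToSinkFinite ms)

sourceToSinkCount-∷ʳ : ∀ ms m → sourceToSinkCount (ms ∷ʳ m) ≡ m * sourceToSinkCount ms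
sourceToSinkCount-∷ʳ []       m = refl
sourceToSinkCount-∷ʳ (k ∷ ms) m = begin
  k * sourceToSinkCount (ms ∷ʳ m)   ≡⟨ cong (k *_) (sourceToSinkCount-∷ʳ ms m) ⟩
  k * (m * sourceToSinkCount ms)    ≡⟨ swap k m (sourceToSinkCount ms) ⟩
  m * (k * sourceToSinkCount ms)    ∎
  where
  open ≡-Reasoning
  swap : ∀ a b c → a * (b * c) ≡ b * (a * c)
  swap = solve-∀

-- Counting is defined by the first edge of a path; this is the recursion by
-- the last edge, in which the count of the shorter graph alone appears.
pathCount-∷ʳ : ∀ ms m → pathCount (ms ∷ʳ m) ≡ 1 + m * pathCount ms
pathCount-∷ʳ []       m = +-comm (m * 1) 1
pathCount-∷ʳ (k ∷ ms) m = begin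
  k * sourceToSinkCount (ms ∷ʳ m) + pathCount (ms ∷ʳ m)
    ≡⟨ cong₂ (λ a p → k * a + p) (sourceToSinkCount-∷ʳ ms m) (pathCount-∷ʳ ms m) ⟩
  k * (m * sourceToSinkCount ms) + (1 + m * pathCount ms)
    ≡⟨ factor k m (sourceToSinkCount ms) (pathCount ms) ⟩
  1 + m * (k * sourceToSinkCount ms + pathCount ms) ∎
  where
  open ≡-Reasoning
  factor : ∀ a b c d → a * (b * c) + (1 + b * d) ≡ 1 + b * (a * c + d)
  factor = solve-∀

-- The optimal counts

-- The eight initial values solve the max-recursion stated at the top; the last
-- clause is its branch m = 3.
best : ℕ → ℕ
best 0 = 1
best 1 = 2
best 2 = 3
best 3 = 5
best 4 = 7
best 5 = 11
best 6 = 16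
best 7 = 23
best (suc (suc (suc n@(suc (suc (suc (suc (suc _)))))))) = 1 + 3 * best n

-- The inequality 2b ≤ 3a is inherited by a, b ↦ 1 + 3a, 1 + 3b, so the three
-- initial ratios 16/11, 23/16 and 34/23 decide it.
best-growth : ∀ n → 2 * best (6 + n) ≤ 3 * best (5 + n)
best-growth 0 = ≤ᵇ⇒≤ _ _ _
best-growth 1 = ≤ᵇ⇒≤ _ _ _
best-growth 2 = ≤ᵇ⇒≤ _ _ _
best-growth (suc (suc (suc n))) = begin
  2 * (1 + 3 * best (6 + n))  ≡⟨ left (best (6 + n)) ⟩
  2 + 3 * (2 * best (6 + n))  ≤⟨ +-mono-≤ (n≤1+n 2) (*-monoʳ-≤ 3 (best-growth n)) ⟩
  3 + 3 * (3 * best (5 + n))  ≡⟨ right (best (5 + n)) ⟩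
  3 * (1 + 3 * best (5 + n))  ∎
  where
  open ≤-Reasoning
  left : ∀ b → 2 * (1 + 3 * b) ≡ 2 + 3 * (2 * b)
  left = solve-∀
  right : ∀ a → 3 + 3 * (3 * a) ≡ 3 * (1 + 3 * a)
  right = solve-∀

best-growth² : ∀ n → best (7 + n) ≤ 3 * best (5 + n)
best-growth² n = *-cancelˡ-≤ 4 (begin
  4 * best (7 + n)        ≡⟨ *-assoc 2 2 (best (7 + n)) ⟩
  2 * (2 * best (7 + n))  ≤⟨ *-monoʳ-≤ 2 (best-growth (suc n)) ⟩
  2 * (3 * best (6 + n))  ≡⟨ swap (best (6 + n)) ⟩
  3 * (2 * best (6 + n))  ≤⟨ *-monoʳ-≤ 3 (best-growth n) ⟩
  3 * (3 * best (5 + n))  ≡⟨ *-assoc 3 3 (best (5 + n)) ⟨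
  9 * best (5 + n)        ≤⟨ *-monoˡ-≤ (best (5 + n)) (m≤m+n 9 3) ⟩
  12 * best (5 + n)       ≡⟨ *-assoc 4 3 (best (5 + n)) ⟩
  4 * (3 * best (5 + n))  ∎)
  where
  open ≤-Reasoning
  swap : ∀ b → 2 * (3 * b) ≡ 3 * (2 * b)
  swap = solve-∀

-- A last bundle of 1 or 2 edges is compared with one of 3 edges as soon as the
-- total is at least 8; smaller totals are read off the table.
best-append : ∀ m n → 1 ≤ m → m ≤ 3 → 1 + m * best n ≤ best (m + n)
best-append 1 0 _ _ = ≤ᵇ⇒≤ _ _ _
best-append 1 1 _ _ = ≤ᵇ⇒≤ _ _ _
best-append 1 2 _ _ = ≤ᵇ⇒≤ _ _ _
best-append 1 3 _ _ = ≤ᵇ⇒≤ _ _ _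
best-append 1 4 _ _ = ≤ᵇ⇒≤ _ _ _
best-append 1 5 _ _ = ≤ᵇ⇒≤ _ _ _
best-append 1 6 _ _ = ≤ᵇ⇒≤ _ _ _
best-append 1 (suc (suc (suc (suc (suc (suc (suc n))))))) _ _ =
  s≤s (≤-trans (≤-reflexive (*-identityˡ (best (7 + n)))) (best-growth² n))
best-append 2 0 _ _ = ≤ᵇ⇒≤ _ _ _
best-append 2 1 _ _ = ≤ᵇ⇒≤ _ _ _
best-append 2 2 _ _ = ≤ᵇ⇒≤ _ _ _
best-append 2 3 _ _ = ≤ᵇ⇒≤ _ _ _
best-append 2 4 _ _ = ≤ᵇ⇒≤ _ _ _
best-append 2 5 _ _ = ≤ᵇ⇒≤ _ _ _
best-append 2 (suc (suc (suc (suc (suc (suc n)))))) _ _ = s≤s (best-growth n)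
best-append 3 0 _ _ = ≤ᵇ⇒≤ _ _ _
best-append 3 1 _ _ = ≤ᵇ⇒≤ _ _ _
best-append 3 2 _ _ = ≤ᵇ⇒≤ _ _ _
best-append 3 3 _ _ = ≤ᵇ⇒≤ _ _ _
best-append 3 4 _ _ = ≤ᵇ⇒≤ _ _ _
best-append 3 (suc (suc (suc (suc (suc n))))) _ _ = ≤-refl
best-append (suc (suc (suc (suc _)))) _ _ (s≤s (s≤s (s≤s ())))

sum-∷ʳ : ∀ ms m → sum (ms ∷ʳ m) ≡ m + sum ms
sum-∷ʳ ms m = begin
  sum (ms ∷ʳ m)     ≡⟨ sum-++ ms (m ∷ []) ⟩
  sum ms + (m + 0)  ≡⟨ cong (sum ms +_) (+-identityʳ m) ⟩
  sum ms + m        ≡⟨ +-comm (sum ms) m ⟩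
  m + sum ms        ∎
  where open ≡-Reasoning

pathCount≤best : ∀ {ms} → Reverse ms → All (1 ≤_) ms → All (_≤ 3) ms →
                 pathCount ms ≤ best (sum ms)
pathCount≤best []               _   _  = ≤-refl
pathCount≤best (ms ∶ rs ∶ʳ m) pos ≤3
  with pos′ , 1≤m ← ∷ʳ⁻ pos | ≤3′ , m≤3 ← ∷ʳ⁻ ≤3 = begin
  pathCount (ms ∷ʳ m)    ≡⟨ pathCount-∷ʳ ms m ⟩
  1 + m * pathCount ms   ≤⟨ s≤s (*-monoʳ-≤ m (pathCount≤best rs pos′ ≤3′)) ⟩
  1 + m * best (sum ms)  ≤⟨ best-append m (sum ms) 1≤m m≤3 ⟩
  best (m + sum ms)      ≡⟨ cong best (sum-∷ʳ ms m) ⟨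
  best (sum (ms ∷ʳ m))   ∎
  where open ≤-Reasoning

-- Graphs attaining the bound

replicate-∷ʳ : ∀ {A : Set} k (x : A) → replicate (suc k) x ≡ replicate k x ∷ʳ x
replicate-∷ʳ zero    x = refl
replicate-∷ʳ (suc k) x = cong (x ∷_) (replicate-∷ʳ k x)

sum-replicate : ∀ k m → sum (replicate k m) ≡ k * m
sum-replicate zero    m = refl
sum-replicate (suc k) m = cong (m +_) (sum-replicate k m)

sum-++-replicate : ∀ ms k m → sum (ms ++ replicate k m) ≡ sum ms + k * m
sum-++-replicate ms k m =
  trans (sum-++ ms (replicate k m)) (cong (sum ms +_) (sum-replicate k m))

-- The hypothesis on best is what makes 3 an optimal last entry at each of the
-- totals reached from ms; it fails, for instance, from the total 2.
pathCount-++-3s : ∀ ms → pathCount ms ≡ best (sum ms) →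
                  (∀ k → best (sum ms + suc k * 3) ≡ 1 + 3 * best (sum ms + k * 3)) →
                  ∀ k → pathCount (ms ++ replicate k 3) ≡ best (sum ms + k * 3)
pathCount-++-3s ms optimal _ zero = begin
  pathCount (ms ++ [])  ≡⟨ cong pathCount (++-identityʳ ms) ⟩
  pathCount ms          ≡⟨ optimal ⟩
  best (sum ms)         ≡⟨ cong best (+-identityʳ (sum ms)) ⟨
  best (sum ms + 0)     ∎
  where open ≡-Reasoning
pathCount-++-3s ms optimal step (suc k) = begin
  pathCount (ms ++ replicate (suc k) 3)     ≡⟨ cong (λ ns → pathCount (ms ++ ns)) (replicate-∷ʳ k 3) ⟩
  pathCount (ms ++ (replicate k 3 ∷ʳ 3))    ≡⟨ cong pathCount (++-assoc ms (replicate k 3) (3 ∷ [])) ⟨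
  pathCount ((ms ++ replicate k 3) ∷ʳ 3)    ≡⟨ pathCount-∷ʳ (ms ++ replicate k 3) 3 ⟩
  1 + 3 * pathCount (ms ++ replicate k 3)   ≡⟨ cong (λ p → 1 + 3 * p) (pathCount-++-3s ms optimal step k) ⟩
  1 + 3 * best (sum ms + k * 3)             ≡⟨ step k ⟨
  best (sum ms + suc k * 3)                 ∎
  where open ≡-Reasoning

-- A value attained by a member of the family and bounding the family is its
-- supremum, so only the count of the given graph has to be compared with best.
realised : ∀ {N} n₂ n₃ → (let ms = 1 ∷ replicate n₂ 2 ++ replicate n₃ 3) →
           sum ms ≡ N → pathCount ms ≡ best N → SupremumRealisedBy N 1 n₂ n₃
realised {N} n₂ n₃ sum≡N count≡best =
  (graph , ms≤3) , refl , bound , λ _ isBound → isBound (graph , ms≤3)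
  where
  ms : List ℕ
  ms = 1 ∷ replicate n₂ 2 ++ replicate n₃ 3

  ms≤3 : All (_≤ 3) ms
  ms≤3 = s≤s z≤n ∷ ++⁺ (replicate⁺ n₂ (n≤1+n 2)) (replicate⁺ n₃ ≤-refl)

  graph : TrunkGraph N
  graph = record
    { mult        = ms
    ; twoVertices = s≤s (s≤s z≤n)
    ; positive    = ≤-refl ∷ ++⁺ (replicate⁺ n₂ (s≤s z≤n)) (replicate⁺ n₃ (s≤s z≤n))
    ; edgeCount   = sum≡N
    }

  bound : ((F , _) : 𝒯₃ N) → Pₛ F ≤ Pₛ graph
  bound (F , ≤3) = begin
    pathCount (mult F)   ≤⟨ pathCount≤best (reverseView (mult F)) (positive F) ≤3 ⟩
    best (sum (mult F))  ≡⟨ cong best (edgeCount F) ⟩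
    best N               ≡⟨ count≡best ⟨
    pathCount ms         ∎
    where open ≤-Reasoning

-- The total 6 is inside the table of best, hence the separate case of one 3.
realised₀ : ∀ k → SupremumRealisedBy (3 + k * 3) 1 1 k
realised₀ k = realised 1 k (sum-++-replicate (1 ∷ 2 ∷ []) k 3)
  (pathCount-++-3s (1 ∷ 2 ∷ []) refl (λ { zero → refl ; (suc _) → refl }) k)

realised₁ : ∀ k → SupremumRealisedBy (7 + k * 3) 1 3 k
realised₁ k = realised 3 k (sum-++-replicate (1 ∷ 2 ∷ 2 ∷ 2 ∷ []) k 3)
  (pathCount-++-3s (1 ∷ 2 ∷ 2 ∷ 2 ∷ []) refl (λ _ → refl) k)

realised₂ : ∀ k → SupremumRealisedBy (5 + k * 3) 1 2 k
realised₂ k = realised 2 k (sum-++-replicate (1 ∷ 2 ∷ 2 ∷ []) k 3)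
  (pathCount-++-3s (1 ∷ 2 ∷ 2 ∷ []) refl (λ _ → refl) k)

theorem4p11 : (N : ℕ) → 5 ≤ N →
    (N % 3 ≡ 0 → SupremumRealisedBy N 1 1 (N / 3 ∸ 1)) ×
    (N % 3 ≡ 1 → SupremumRealisedBy N 1 3 (N / 3 ∸ 2)) ×
    (N % 3 ≡ 2 → SupremumRealisedBy N 1 2 (N / 3 ∸ 1))
theorem4p11 N 5≤N =
    (λ r≡0 → case₀ (N / 3) 5≤N (decompose r≡0))
  , (λ r≡1 → case₁ (N / 3) 5≤N (decompose r≡1))
  , (λ r≡2 → case₂ (N / 3) 5≤N (decompose r≡2))
  where
  decompose : ∀ {r} → N % 3 ≡ r → N ≡ r + N / 3 * 3
  decompose r≡ = subst (λ r → N ≡ r + N / 3 * 3) r≡ (m≡m%n+[m/n]*n N 3)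

  case₀ : ∀ {M} q → 5 ≤ M → M ≡ q * 3 → SupremumRealisedBy M 1 1 (q ∸ 1)
  case₀ zero    ()  refl
  case₀ (suc k) _   refl = realised₀ k

  case₁ : ∀ {M} q → 5 ≤ M → M ≡ 1 + q * 3 → SupremumRealisedBy M 1 3 (q ∸ 2)
  case₁ zero          (s≤s ())                   refl
  case₁ (suc zero)    (s≤s (s≤s (s≤s (s≤s ())))) refl
  case₁ (suc (suc k)) _                          refl = realised₁ k

  case₂ : ∀ {M} q → 5 ≤ M → M ≡ 2 + q * 3 → SupremumRealisedBy M 1 2 (q ∸ 1)
  case₂ zero    (s≤s (s≤s ())) refl
  case₂ (suc k) _              refl = realised₂ k
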